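{- The second moment of the one-parameter family $E: y^2=4x^3+(4m+1)x^2+n\cdot t x$ (with parameter $t$ and integers $m,n$) is $$A_{2,E}(p)=\begin{cases} p^2-3p & \text{if } p=4k+1,\\ p^2-p & \text{if } p=4k+3,\end{cases}$$ where $k$ denotes an integer.
   Context: Here $p$ is an odd prime and $\left(\frac{\cdot}{p}\right)$ denotes the Legendre symbol, with $\left(\frac{u}{p}\right)=0$ if $p\mid u$. For a family $y^2=f_t(x)$, with $f_t(x)$ a cubic polynomial in $x$ whose coefficients are integer polynomials in $t$, one sets $a_t(p):=p-\#\{(x,y)\in(\mathbb{Z}/p\mathbb{Z})^2: y^2\equiv f_t(x) \bmod p\}=-\sum_{x \bmod p}\left(\frac{f_t(x)}{p}\right)$. The second moment is taken here without averaging over $t$: $A_{2,E}(p):=\sum_{t \bmod p}a_t(p)^2$, the sum running over all residues $t$ modulo $p$.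
   Formalization: The formal statement adds the hypotheses that p divides neither n nor 4m+1; without them the formula is false (for p=3, m=n=0 the second moment is 3, not 6; for p=5, m=n=1 it is 40, not 10), and it fails for every prime so excluded. -}

module Defs where

open import Algebra.Properties.Monoid.Sum using (sum-syntax)
open import Data.Fin.Base using (Fin; toℕ)
open import Data.Integer.Base using (ℤ; +_; _+_; _-_; _*_; _^_)
open import Data.Integer.Divisibility.Signed using (_∣_; _∣?_)
open import Data.Integer.Properties using (+-0-monoid)
open import Data.List.Base using (List; allFin; cartesianProduct; filter; length)
open import Data.Nat.Base using (ℕ)
open import Data.Product.Base using (_×_; _,_)
open import Relation.Unary using (Decidable)

-- A family y² = f_t(x) is given by its right-hand side: f t x stands for f_t(x).
-- The notions below are used for f an integer polynomial in t and x, so that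
-- f t x mod p depends only on t mod p and x mod p.
Family : Set
Family = ℤ → ℤ → ℤ

-- Elements of ℤ/pℤ are represented by their least residues 0, …, p - 1.
residue : ∀ {p} → Fin p → ℤ
residue i = + toℕ i

IsPoint : ∀ p → Family → ℤ → Fin p × Fin p → Set
IsPoint p f t (x , y) = + p ∣ residue y ^ 2 - f t (residue x)

isPoint? : ∀ p f t → Decidable (IsPoint p f t)
isPoint? p f t (x , y) = + p ∣? residue y ^ 2 - f t (residue x)

-- Affine points only: the point at infinity is not counted.
points : ∀ p → Family → ℤ → List (Fin p × Fin p)
points p f t = filter (isPoint? p f t) (cartesianProduct (allFin p) (allFin p))

a : ℕ → Family → ℤ → ℤ
a p f t = + p - + length (points p f t)

-- Not averaged: there is no division by p.
A₂ : ℕ → Family → ℤ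
A₂ p f = sum-syntax +-0-monoid p (λ t → a p f (residue t) ^ 2)

E : ℤ → ℤ → Family
E m n t x = + 4 * x ^ 3 + (+ 4 * m + + 1) * x ^ 2 + n * t * x

{-# OPTIONS --safe #-}
module Submission where

open import Defs
open import Data.Integer.Base using (ℤ; +_; _+_; _-_; _*_; _^_)
open import Data.Integer.Divisibility.Signed using (_∣_)
open import Data.Nat.Base using (ℕ)
open import Data.Nat.Primality using (Prime)
open import Data.Product.Base using (_×_; ∃-syntax)
open import Relation.Binary.PropositionalEquality.Core using (_≡_; _≢_)
open import Relation.Nullary.Negation.Core using (¬_)

open import Algebra.Bundles using (CommutativeRing)
open import Algebra.Properties.CommutativeMonoid.Sum using (sum-remove; ∑-distrib-+; ∑-comm)
open import Algebra.Properties.Monoid.Sum using (sum; sum-cong-≗)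
open import Algebra.Properties.Semiring.Sum using (*-distribˡ-sum; *-distribʳ-sum)
open import Data.Bool.Base using (if_then_else_)
open import Data.Empty using (⊥-elim)
open import Data.Fin.Base using (Fin; zero; suc; toℕ; fromℕ<; punchIn)
open import Data.Fin.Properties using (any?; toℕ<n; toℕ-fromℕ<; toℕ-injective; punchInᵢ≢i)
open import Data.Integer.Base using (-_; ∣_∣; _≤_; _⊖_; 0ℤ; 1ℤ; -1ℤ; -≤+; +≤+)
open import Data.Integer.DivMod using (_%ℕ_; _/ℕ_; a≡a%ℕn+[a/ℕn]*n; n%ℕd<d)
open import Data.Integer.Divisibility.Signed
  using (divides; _∣?_; ∣ᵤ⇒∣; ∣⇒∣ᵤ; ∣-refl; ∣m∣n⇒∣m+n; ∣n⇒∣m*n; ∣m⇒∣m*n)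
open import Data.Integer.Properties
  using (+-0-monoid; +-0-commutativeMonoid; +-*-commutativeRing; +-identityˡ; +-identityʳ; +-inverseʳ; +-comm;
         *-comm; *-identityˡ; *-identityʳ; *-zeroˡ; *-zeroʳ; abs-*; ∣i∣≡0⇒i≡0; +-injective; pos-+; pos-*;
         m-n≡m⊖n; ∣m⊝n∣≤m⊔n; i-j≡0⇒i≡j; i*j≡0⇒i≡0∨j≡0; ≤-refl; ≤-antisym; ≤-reflexive; +-mono-≤; +-monoʳ-≤;
         module ≤-Reasoning)
open import Data.Integer.Tactic.RingSolver using (solve-∀)
open import Data.List.Base using (_++_; filter; length; tabulate; map; cartesianProduct)
open import Data.List.Properties using (length-++; filter-++; map-tabulate)
open import Data.Nat.Base as ℕ using (zero; suc; NonZero)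
open import Data.Nat.Coprimality using (prime⇒coprime; coprime-Bézout)
import Data.Nat.Divisibility as ℕ
open import Data.Nat.GCD using (module Bézout)
open import Data.Nat.Primality using (prime⇒nonZero; prime⇒nonTrivial; euclidsLemma)
import Data.Nat.Properties as ℕ
open import Data.Product.Base using (_,_; proj₁; proj₂)
open import Data.Sum.Base as Sum using (_⊎_; inj₁; inj₂; [_,_]′)
open import Function.Base using (_∘_; id)
open import Relation.Binary.PropositionalEquality
  using (refl; sym; trans; cong; cong₂; subst; module ≡-Reasoning)
open import Relation.Nullary using (Dec; yes; no; does)
open import Relation.Nullary.Decidable.Core using (from-no)
open import Relation.Unary using (Decidable)

-- Let χ be the quadratic character mod p and write c = 4m + 1, U(x) = 4x² + cx, so that
-- a_t = - Σ_x χ(x) χ(U(x) + nt). Since Σ_t χ(u + nt) χ(v + nt) is p - 1 if u ≡ v and -1 otherwise, and Σ χ = 0,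
-- the second moment is p Σ χ(xy) over the pairs with U(x) ≡ U(y). These lie on the lines x = y and x + y = - c / 4,
-- which contribute p - 1 and - χ(-1) and share one point, contributing 1: in total p (p - 2 - χ(-1)).
-- Finally χ(-1) ≡ p mod 4.

-- The character is defined by root counting, so periodicity and `Σχ≡0` come cheaply, while
-- multiplicativity is the obstacle: nothing counts the squares mod p or supplies a primitive root.
-- Squares act trivially by rescaling roots; for a nonsquare u, vanishing of a sum of nonpositive
-- terms forces χ(uv) = - χ(v). The value -1 of the shifted correlation is not computed directly
-- either: rescaling t shows that all nonzero shifts give the same value, and summing over all
-- shifts gives 0, which determines it. The two nondivisibility hypotheses enter as follows. As p
-- does not divide n, u + nt runs through all residues with t. As p does not divide c, the line x +
-- y = - c / 4 misses the origin, so its contribution is a correlation at a nonzero shift, and its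
-- common point with the diagonal has nonzero coordinates. The congruence for χ(-1) needs no Euler
-- criterion: a Jacobi sum is read modulo 4.

private
  ∑ : ∀ {n} → (Fin n → ℤ) → ℤ
  ∑ = sum +-0-monoid

  ℤ-semiring = CommutativeRing.semiring +-*-commutativeRing

-- Indicators, and lengths of filtered lists as sums.

indicator : {P : Set} → Dec P → ℤ
indicator P? = if does P? then 1ℤ else 0ℤ

indicator-true : {P : Set} (P? : Dec P) → P → indicator P? ≡ 1ℤ
indicator-true (yes _) _ = refl
indicator-true (no ¬p) p = ⊥-elim (¬p p)

indicator-false : {P : Set} (P? : Dec P) → ¬ P → indicator P? ≡ 0ℤ
indicator-false (yes p) ¬p = ⊥-elim (¬p p)
indicator-false (no _)  _  = refl

indicator-⇔ : {P Q : Set} (P? : Dec P) (Q? : Dec Q) → (P → Q) → (Q → P) →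
              indicator P? ≡ indicator Q?
indicator-⇔ (yes p) Q? f g = sym (indicator-true Q? (f p))
indicator-⇔ (no ¬p) Q? f g = sym (indicator-false Q? (¬p ∘ g))

module _ {A : Set} {P : A → Set} (P? : Decidable P) where

  length-filter-tabulate : ∀ {n} (f : Fin n → A) →
    + length (filter P? (tabulate f)) ≡ ∑ (λ i → indicator (P? (f i)))
  length-filter-tabulate {zero}  f = refl
  length-filter-tabulate {suc n} f with P? (f zero)
  ... | yes _ = cong (_+_ 1ℤ) (length-filter-tabulate (f ∘ suc))
  ... | no  _ = trans (length-filter-tabulate (f ∘ suc)) (sym (+-identityˡ _))

length-filter-product : {A B : Set} {P : A × B → Set} (P? : Decidable P) →
  ∀ {m n} (f : Fin m → A) (g : Fin n → B) →
  + length (filter P? (cartesianProduct (tabulate f) (tabulate g)))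
  ≡ ∑ (λ i → ∑ (λ j → indicator (P? (f i , g j))))
length-filter-product P? {zero}  f g = refl
length-filter-product P? {suc m} f g = begin
  + length (filter P? (row ++ rows))                       ≡⟨ cong (+_ ∘ length) (filter-++ P? row rows) ⟩
  + length (filter P? row ++ filter P? rows)               ≡⟨ cong +_ (length-++ (filter P? row)) ⟩
  + (length (filter P? row) ℕ.+ length (filter P? rows))   ≡⟨ pos-+ (length (filter P? row)) _ ⟩
  + length (filter P? row) + + length (filter P? rows)
    ≡⟨ cong (λ r → + length (filter P? r) + + length (filter P? rows)) (map-tabulate g (f zero ,_)) ⟩
  + length (filter P? (tabulate (λ j → f zero , g j))) + + length (filter P? rows)
    ≡⟨ cong₂ _+_ (length-filter-tabulate P? (λ j → f zero , g j)) (length-filter-product P? (f ∘ suc) g) ⟩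
  ∑ (λ i → ∑ (λ j → indicator (P? (f i , g j)))) ∎
  where
  open ≡-Reasoning
  row  = map (f zero ,_) (tabulate g)
  rows = cartesianProduct (tabulate (f ∘ suc)) (tabulate g)

-- Finite sums of integers.

∑-1 : ∀ n → ∑ {n} (λ _ → 1ℤ) ≡ + n
∑-1 zero    = refl
∑-1 (suc n) = cong (_+_ 1ℤ) (∑-1 n)

∑-0 : ∀ {n} {f : Fin n → ℤ} → (∀ i → f i ≡ 0ℤ) → ∑ f ≡ 0ℤ
∑-0 {zero}  f≡0 = refl
∑-0 {suc n} f≡0 = cong₂ _+_ (f≡0 zero) (∑-0 (f≡0 ∘ suc))

∑-∣ : ∀ {k n} {f : Fin n → ℤ} → (∀ i → k ∣ f i) → k ∣ ∑ f
∑-∣ {k} {zero}  k∣f = divides 0ℤ (sym (*-zeroˡ k))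
∑-∣ {n = suc n} k∣f = ∣m∣n⇒∣m+n (k∣f zero) (∑-∣ (k∣f ∘ suc))

∑-≤0 : ∀ {n} {f : Fin n → ℤ} → (∀ i → f i ≤ 0ℤ) → ∑ f ≤ 0ℤ
∑-≤0 {zero}  f≤0 = ≤-refl
∑-≤0 {suc n} f≤0 = +-mono-≤ (f≤0 zero) (∑-≤0 (f≤0 ∘ suc))

∑-single : ∀ {n} (f : Fin n → ℤ) i → (∀ j → j ≢ i → f j ≡ 0ℤ) → ∑ f ≡ f i
∑-single {suc n} f i f≡0 = begin
  ∑ f                          ≡⟨ sum-remove +-0-commutativeMonoid {i = i} f ⟩
  f i + ∑ (f ∘ punchIn i)      ≡⟨ cong (_+_ (f i)) (∑-0 (λ j → f≡0 _ (punchInᵢ≢i i j))) ⟩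
  f i + 0ℤ                     ≡⟨ +-identityʳ (f i) ⟩
  f i                          ∎
  where open ≡-Reasoning

-- Dropping the other, nonpositive terms bounds the whole sum 0 by the single term `f i`.
∑-≤0-≡0 : ∀ {n} {f : Fin n → ℤ} → (∀ i → f i ≤ 0ℤ) → ∑ f ≡ 0ℤ → ∀ i → f i ≡ 0ℤ
∑-≤0-≡0 {suc n} {f} f≤0 ∑f≡0 i = ≤-antisym (f≤0 i) (begin
  0ℤ                        ≡⟨ ∑f≡0 ⟨
  ∑ f                       ≡⟨ sum-remove +-0-commutativeMonoid {i = i} f ⟩
  f i + ∑ (f ∘ punchIn i)   ≤⟨ +-monoʳ-≤ (f i) (∑-≤0 (f≤0 ∘ punchIn i)) ⟩
  f i + 0ℤ                  ≡⟨ +-identityʳ (f i) ⟩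
  f i                       ∎)
  where open ≤-Reasoning

∣-scale : ∀ {d u v} k → d ∣ u → v ≡ k * u → d ∣ v
∣-scale k d∣u refl = ∣n⇒∣m*n k d∣u

-- Congruences are proved by exhibiting coefficients; the remaining equation is an identity over ℤ,
-- left to the ring solver.
∣-combine : ∀ {d u v w} k l → d ∣ u → d ∣ v → w ≡ k * u + l * v → d ∣ w
∣-combine k l d∣u d∣v refl = ∣m∣n⇒∣m+n (∣n⇒∣m*n k d∣u) (∣n⇒∣m*n l d∣v)

-- Residue classes modulo a prime.

module Residues {p : ℕ} (p-prime : Prime p) where

  instance
    p≢0 : NonZero p
    p≢0 = prime⇒nonZero p-prime

  p∣_ : ℤ → Set
  p∣ u = + p ∣ u

  -- Functions on ℤ/pℤ are encoded as functions on ℤ that respect congruence, so that arguments are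
  -- manipulated as ordinary integers.
  Periodic : (ℤ → ℤ) → Set
  Periodic f = ∀ x y → p∣ (x - y) → f x ≡ f y

  rep : ℤ → Fin p
  rep u = fromℕ< (n%ℕd<d u p)

  residue-rep : ∀ u → p∣ (residue (rep u) - u)
  residue-rep u = divides (- (u /ℕ p)) (begin
    residue (rep u) - u                      ≡⟨ cong₂ (λ r v → + r - v) (toℕ-fromℕ< (n%ℕd<d u p)) (a≡a%ℕn+[a/ℕn]*n u p) ⟩
    + (u %ℕ p) - (+ (u %ℕ p) + u /ℕ p * + p) ≡⟨ lemma (+ (u %ℕ p)) (u /ℕ p) (+ p) ⟩
    - (u /ℕ p) * + p                         ∎)
    where
    open ≡-Reasoning
    lemma : ∀ r q n → r - (r + q * n) ≡ - q * n
    lemma = solve-∀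

  p∣-* : ∀ u v → p∣ (u * v) → p∣ u ⊎ p∣ v
  p∣-* u v p∣uv = Sum.map ∣ᵤ⇒∣ ∣ᵤ⇒∣
    (euclidsLemma ∣ u ∣ ∣ v ∣ p-prime (subst (p ℕ.∣_) (abs-* u v) (∣⇒∣ᵤ p∣uv)))

  p∤1 : ¬ p∣ 1ℤ
  p∤1 p∣1 = ℕ.nonTrivial⇒≢1 {{prime⇒nonTrivial p-prime}} (ℕ.∣1⇒≡1 (∣⇒∣ᵤ p∣1))

  -- Two least residues differ by less than p in absolute value, so a difference divisible by p is
  -- 0.
  residue-injective : ∀ (i j : Fin p) → p∣ (residue i - residue j) → i ≡ j
  residue-injective i j p∣i-j with residue i - residue j in eq
  ... | d with ∣ d ∣ in ∣d∣≡
  ...   | zero  = toℕ-injective (+-injective (i-j≡0⇒i≡j _ _ (trans eq (∣i∣≡0⇒i≡0 ∣d∣≡))))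
  ...   | suc k = ⊥-elim (ℕ.<⇒≱ small (ℕ.∣⇒≤ (subst (p ℕ.∣_) ∣d∣≡ (∣⇒∣ᵤ p∣i-j))))
    where
    open ℕ.≤-Reasoning
    small : suc k ℕ.< p
    small = begin-strict
      suc k                     ≡⟨ trans (cong ∣_∣ eq) ∣d∣≡ ⟨
      ∣ residue i - residue j ∣ ≡⟨ cong ∣_∣ (m-n≡m⊖n (toℕ i) (toℕ j)) ⟩
      ∣ toℕ i ⊖ toℕ j ∣         ≤⟨ ∣m⊝n∣≤m⊔n (toℕ i) (toℕ j) ⟩
      toℕ i ℕ.⊔ toℕ j           <⟨ ℕ.⊔-lub (toℕ<n i) (toℕ<n j) ⟩
      p                         ∎

  -- Bézout for p and the nonzero least residue of u. Its coefficients are natural numbers, so the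
  -- two forms of the identity give the inverse with opposite signs.
  inverse : ∀ u → ¬ p∣ u → ∃[ v ] p∣ (v * u - 1ℤ)
  inverse u p∤u with u %ℕ p in eq | a≡a%ℕn+[a/ℕn]*n u p | n%ℕd<d u p
  ... | zero  | u≡ | _   = ⊥-elim (p∤u (divides (u /ℕ p) (trans u≡ (+-identityˡ _))))
  ... | suc r | u≡ | r<p with coprime-Bézout (prime⇒coprime p-prime r<p)
  ...   | Bézout.+- x y 1+yr≡xp = - + y , divides (- + x - + y * (u /ℕ p)) (begin
    - + y * u - 1ℤ                               ≡⟨ cong (λ w → - + y * w - 1ℤ) u≡ ⟩
    - + y * (+ suc r + u /ℕ p * + p) - 1ℤ        ≡⟨ lemma (+ y) (+ suc r) (u /ℕ p) (+ p) ⟩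
    - (1ℤ + + y * + suc r) - + y * (u /ℕ p) * + p ≡⟨ cong (λ w → - w - + y * (u /ℕ p) * + p) bez ⟩
    - (+ x * + p) - + y * (u /ℕ p) * + p         ≡⟨ lemma′ (+ x) (+ y * (u /ℕ p)) (+ p) ⟩
    (- + x - + y * (u /ℕ p)) * + p               ∎)
    where
    open ≡-Reasoning
    lemma : ∀ y r q n → - y * (r + q * n) - 1ℤ ≡ - (1ℤ + y * r) - y * q * n
    lemma = solve-∀
    lemma′ : ∀ x w n → - (x * n) - w * n ≡ (- x - w) * n
    lemma′ = solve-∀
    bez : 1ℤ + + y * + suc r ≡ + x * + p
    bez = trans (cong (λ w → 1ℤ + w) (sym (pos-* y (suc r)))) (trans (cong +_ 1+yr≡xp) (pos-* x p))
  ...   | Bézout.-+ x y 1+xp≡yr = + y , divides (+ x + + y * (u /ℕ p)) (begin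
    + y * u - 1ℤ                               ≡⟨ cong (λ w → + y * w - 1ℤ) u≡ ⟩
    + y * (+ suc r + u /ℕ p * + p) - 1ℤ        ≡⟨ lemma (+ y) (+ suc r) (u /ℕ p) (+ p) ⟩
    + y * + suc r - 1ℤ + + y * (u /ℕ p) * + p  ≡⟨ cong (λ w → w - 1ℤ + + y * (u /ℕ p) * + p) bez ⟨
    1ℤ + + x * + p - 1ℤ + + y * (u /ℕ p) * + p ≡⟨ lemma′ (+ x) (+ y * (u /ℕ p)) (+ p) ⟩
    (+ x + + y * (u /ℕ p)) * + p               ∎)
    where
    open ≡-Reasoning
    lemma : ∀ y r q n → y * (r + q * n) - 1ℤ ≡ y * r - 1ℤ + y * q * n
    lemma = solve-∀
    lemma′ : ∀ x w n → 1ℤ + x * n - 1ℤ + w * n ≡ (x + w) * n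
    lemma′ = solve-∀
    bez : 1ℤ + + x * + p ≡ + y * + suc r
    bez = trans (cong (λ w → 1ℤ + w) (sym (pos-* x p))) (trans (cong +_ 1+xp≡yr) (pos-* y (suc r)))

  -- Sums over a complete system of residues.

  opaque
    Σₚ : (ℤ → ℤ) → ℤ
    Σₚ f = ∑ {p} (λ i → f (residue i))

    Σ-def : ∀ f → Σₚ f ≡ ∑ {p} (λ i → f (residue i))
    Σ-def f = refl

    Σ-cong : ∀ {f g} → (∀ x → f x ≡ g x) → Σₚ f ≡ Σₚ g
    Σ-cong f≗g = sum-cong-≗ +-0-monoid {p} (λ i → f≗g (residue i))

    Σ-plus : ∀ f g → Σₚ (λ x → f x + g x) ≡ Σₚ f + Σₚ g
    Σ-plus f g = ∑-distrib-+ +-0-commutativeMonoid {p} (f ∘ residue {p}) (g ∘ residue {p})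

    Σ-*ˡ : ∀ c f → Σₚ (λ x → c * f x) ≡ c * Σₚ f
    Σ-*ˡ c f = sym (*-distribˡ-sum ℤ-semiring {p} c (f ∘ residue {p}))

    Σ-*ʳ : ∀ c f → Σₚ (λ x → f x * c) ≡ Σₚ f * c
    Σ-*ʳ c f = sym (*-distribʳ-sum ℤ-semiring {p} c (f ∘ residue {p}))

    Σ-swap : ∀ (f : ℤ → ℤ → ℤ) → Σₚ (λ x → Σₚ (λ y → f x y)) ≡ Σₚ (λ y → Σₚ (λ x → f x y))
    Σ-swap f = ∑-comm +-0-commutativeMonoid {p} {p} (λ i j → f (residue i) (residue j))

    Σ-1 : Σₚ (λ _ → 1ℤ) ≡ + p
    Σ-1 = ∑-1 p

    Σ-0 : ∀ {f} → (∀ (i : Fin p) → f (residue i) ≡ 0ℤ) → Σₚ f ≡ 0ℤ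
    Σ-0 = ∑-0 {p}

    Σ-single : ∀ f (i : Fin p) → (∀ j → j ≢ i → f (residue j) ≡ 0ℤ) → Σₚ f ≡ f (residue i)
    Σ-single f = ∑-single {p} (λ i → f (residue i))

    Σ-∣ : ∀ {k f} → (∀ x → k ∣ f x) → k ∣ Σₚ f
    Σ-∣ k∣f = ∑-∣ {n = p} (λ i → k∣f (residue i))

    Σ-≤0-≡0 : ∀ {f} → (∀ x → f x ≤ 0ℤ) → Σₚ f ≡ 0ℤ → ∀ (i : Fin p) → f (residue i) ≡ 0ℤ
    Σ-≤0-≡0 f≤0 = ∑-≤0-≡0 {p} (λ i → f≤0 (residue i))

  Σ-const : ∀ c → Σₚ (λ _ → c) ≡ + p * c
  Σ-const c = begin
    Σₚ (λ _ → c)          ≡⟨ Σ-cong (λ _ → *-identityˡ c) ⟨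
    Σₚ (λ _ → 1ℤ * c)     ≡⟨ Σ-*ʳ c (λ _ → 1ℤ) ⟩
    Σₚ (λ _ → 1ℤ) * c     ≡⟨ cong (_* c) Σ-1 ⟩
    + p * c               ∎
    where open ≡-Reasoning

  Σ-minus : ∀ f g → Σₚ (λ x → f x - g x) ≡ Σₚ f - Σₚ g
  Σ-minus f g = begin
    Σₚ (λ x → f x - g x)             ≡⟨ Σ-cong (λ x → neg (f x) (g x)) ⟩
    Σₚ (λ x → f x + -1ℤ * g x)       ≡⟨ Σ-plus f (λ x → -1ℤ * g x) ⟩
    Σₚ f + Σₚ (λ x → -1ℤ * g x)      ≡⟨ cong (_+_ (Σₚ f)) (Σ-*ˡ -1ℤ g) ⟩
    Σₚ f + -1ℤ * Σₚ g                ≡⟨ neg (Σₚ f) (Σₚ g) ⟨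
    Σₚ f - Σₚ g                      ∎
    where
    open ≡-Reasoning
    neg : ∀ a b → a - b ≡ a + -1ℤ * b
    neg = solve-∀

  -- The delta function mod p, sifting and change of variable.

  opaque
    δ : ℤ → ℤ
    δ u = indicator (+ p ∣? u)

    δ-def : ∀ u → δ u ≡ indicator (+ p ∣? u)
    δ-def u = refl

    δ-true : ∀ {u} → p∣ u → δ u ≡ 1ℤ
    δ-true {u} = indicator-true (+ p ∣? u)

    δ-false : ∀ {u} → ¬ p∣ u → δ u ≡ 0ℤ
    δ-false {u} = indicator-false (+ p ∣? u)

    δ-⇔ : ∀ {u v} → (p∣ u → p∣ v) → (p∣ v → p∣ u) → δ u ≡ δ v
    δ-⇔ {u} {v} = indicator-⇔ (+ p ∣? u) (+ p ∣? v)

  p∣-sym : ∀ x y → p∣ (x - y) → p∣ (y - x)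
  p∣-sym x y p∣x-y = ∣-scale -1ℤ p∣x-y (lemma x y)
    where
    lemma : ∀ x y → y - x ≡ -1ℤ * (x - y)
    lemma = solve-∀

  p∣-transport : ∀ x y → p∣ (x - y) → p∣ x → p∣ y
  p∣-transport x y p∣x-y p∣x = ∣-combine 1ℤ -1ℤ p∣x p∣x-y (lemma x y)
    where
    lemma : ∀ x y → y ≡ 1ℤ * x + -1ℤ * (x - y)
    lemma = solve-∀

  δ-periodic : Periodic δ
  δ-periodic x y x≈y = δ-⇔ (p∣-transport x y x≈y) (p∣-transport y x (p∣-sym x y x≈y))

  -- Inclusion-exclusion, with Euclid's lemma: this is how a factored congruence becomes a union of
  -- lines.
  δ-* : ∀ u v → δ (u * v) ≡ δ u + δ v - δ u * δ v
  δ-* u v with + p ∣? u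
  ... | yes p∣u rewrite δ-true p∣u | δ-true (∣m⇒∣m*n v p∣u) = lemma (δ v)
    where
    lemma : ∀ d → 1ℤ ≡ 1ℤ + d - 1ℤ * d
    lemma = solve-∀
  ... | no p∤u rewrite δ-false p∤u =
    trans (δ-⇔ (λ p∣uv → [ (λ p∣u → ⊥-elim (p∤u p∣u)) , id ]′ (p∣-* u v p∣uv)) (∣n⇒∣m*n u)) (lemma (δ v))
    where
    lemma : ∀ d → d ≡ 0ℤ + d - 0ℤ * d
    lemma = solve-∀

  Σ-sift : ∀ {f} → Periodic f → ∀ c → Σₚ (λ x → f x * δ (x - c)) ≡ f c
  Σ-sift {f} f-periodic c = begin
    Σₚ (λ x → f x * δ (x - c))                        ≡⟨ Σ-single (λ x → f x * δ (x - c)) (rep c) vanish ⟩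
    f (residue (rep c)) * δ (residue (rep c) - c)     ≡⟨ cong₂ _*_ (f-periodic _ _ (residue-rep c)) (δ-true (residue-rep c)) ⟩
    f c * 1ℤ                                          ≡⟨ *-identityʳ (f c) ⟩
    f c                                               ∎
    where
    open ≡-Reasoning
    lemma : ∀ x r c → x - r ≡ 1ℤ * (x - c) + -1ℤ * (r - c)
    lemma = solve-∀
    vanish : ∀ j → j ≢ rep c → f (residue j) * δ (residue j - c) ≡ 0ℤ
    vanish j j≢ = trans (cong (f (residue j) *_) (δ-false λ p∣j-c →
      j≢ (residue-injective j (rep c)
        (∣-combine 1ℤ -1ℤ p∣j-c (residue-rep c) (lemma (residue j) (residue (rep c)) c)))))
      (*-zeroʳ (f (residue j)))

  Σ-δ : ∀ c → Σₚ (λ x → δ (x - c)) ≡ 1ℤ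
  Σ-δ c = trans (Σ-cong λ x → sym (*-identityˡ (δ (x - c)))) (Σ-sift {λ _ → 1ℤ} (λ _ _ _ → refl) c)

  Σδ : Σₚ δ ≡ 1ℤ
  Σδ = trans (Σ-cong λ x → cong δ (sym (+-identityʳ x))) (Σ-δ 0ℤ)

  -- Instead of building a permutation of `Fin p`, each value is spread out by sifting and the sums
  -- are exchanged; every y then has the single preimage `v * (y - b)`, with v inverse to u.
  Σ-affine : ∀ {f} → Periodic f → ∀ u b → ¬ p∣ u → Σₚ (λ x → f (u * x + b)) ≡ Σₚ f
  Σ-affine {f} f-periodic u b p∤u = begin
    Σₚ (λ x → f (u * x + b))
      ≡⟨ Σ-cong (λ x → Σ-sift f-periodic (u * x + b)) ⟨
    Σₚ (λ x → Σₚ (λ y → f y * δ (y - (u * x + b))))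
      ≡⟨ Σ-swap (λ x y → f y * δ (y - (u * x + b))) ⟩
    Σₚ (λ y → Σₚ (λ x → f y * δ (y - (u * x + b))))
      ≡⟨ Σ-cong (λ y → trans (Σ-*ˡ (f y) (λ x → δ (y - (u * x + b))))
                      (trans (cong (f y *_) (preimage y)) (*-identityʳ (f y)))) ⟩
    Σₚ f ∎
    where
    open ≡-Reasoning
    v   = proj₁ (inverse u p∤u)
    vu≈1 = proj₂ (inverse u p∤u)
    forth : ∀ u v x y b → x - v * (y - b) ≡ - v * (y - (u * x + b)) + - x * (v * u - 1ℤ)
    forth = solve-∀
    back : ∀ u v x y b → y - (u * x + b) ≡ - u * (x - v * (y - b)) + (b - y) * (v * u - 1ℤ)
    back = solve-∀
    preimage : ∀ y → Σₚ (λ x → δ (y - (u * x + b))) ≡ 1ℤ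
    preimage y = trans
      (Σ-cong λ x → δ-⇔
        (λ d → ∣-combine (- v) (- x) d vu≈1 (forth u v x y b))
        (λ d → ∣-combine (- u) (b - y) d vu≈1 (back u v x y b)))
      (Σ-δ (v * (y - b)))

  -- The quadratic character.

  opaque
    -- The quadratic character: a residue class u has 1 + χ u square roots mod p.
    χ : ℤ → ℤ
    χ u = Σₚ (λ y → δ (y * y - u)) - 1ℤ

    χ-def : ∀ u → χ u ≡ Σₚ (λ y → δ (y * y - u)) - 1ℤ
    χ-def u = refl

  χ-periodic : Periodic χ
  χ-periodic u v u≈v = begin
    χ u                                  ≡⟨ χ-def u ⟩
    Σₚ (λ y → δ (y * y - u)) - 1ℤ        ≡⟨ cong (_- 1ℤ) (Σ-cong λ y → δ-periodic _ _ (∣-scale -1ℤ u≈v (lemma y u v))) ⟩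
    Σₚ (λ y → δ (y * y - v)) - 1ℤ        ≡⟨ χ-def v ⟨
    χ v                                  ∎
    where
    open ≡-Reasoning
    lemma : ∀ y u v → y * y - u - (y * y - v) ≡ -1ℤ * (u - v)
    lemma = solve-∀

  -- Counting the pairs with y² ≡ u by y instead of u gives one u for each y, hence p pairs, which
  -- cancel the p subtracted ones.
  Σχ≡0 : Σₚ χ ≡ 0ℤ
  Σχ≡0 = begin
    Σₚ χ                                                      ≡⟨ Σ-cong χ-def ⟩
    Σₚ (λ u → Σₚ (λ y → δ (y * y - u)) - 1ℤ)                  ≡⟨ Σ-minus (λ u → Σₚ (λ y → δ (y * y - u))) (λ _ → 1ℤ) ⟩
    Σₚ (λ u → Σₚ (λ y → δ (y * y - u))) - Σₚ (λ _ → 1ℤ)       ≡⟨ cong (_- Σₚ (λ _ → 1ℤ)) fibres ⟩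
    Σₚ (λ _ → 1ℤ) - Σₚ (λ _ → 1ℤ)                             ≡⟨ +-inverseʳ (Σₚ (λ _ → 1ℤ)) ⟩
    0ℤ                                                        ∎
    where
    open ≡-Reasoning
    fibre : ∀ y → Σₚ (λ u → δ (y * y - u)) ≡ 1ℤ
    fibre y = trans (Σ-cong λ u → δ-⇔ (p∣-sym (y * y) u) (p∣-sym u (y * y))) (Σ-δ (y * y))
    fibres : Σₚ (λ u → Σₚ (λ y → δ (y * y - u))) ≡ Σₚ (λ _ → 1ℤ)
    fibres = trans (Σ-swap (λ u y → δ (y * y - u))) (Σ-cong fibre)

  χ-multiple : ∀ {u} → p∣ u → χ u ≡ 0ℤ
  χ-multiple {u} p∣u = begin
    χ u                                    ≡⟨ χ-def u ⟩
    Σₚ (λ y → δ (y * y - u)) - 1ℤ          ≡⟨ cong (_- 1ℤ) (Σ-cong λ y → δ-⇔ (forth y) (back y)) ⟩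
    Σₚ (λ y → δ (y - 0ℤ)) - 1ℤ             ≡⟨ cong (_- 1ℤ) (Σ-δ 0ℤ) ⟩
    0ℤ                                     ∎
    where
    open ≡-Reasoning
    lemma₁ : ∀ y u → y * y ≡ 1ℤ * (y * y - u) + 1ℤ * u
    lemma₁ = solve-∀
    lemma₂ : ∀ y u → y * y - u ≡ y * (y - 0ℤ) + -1ℤ * u
    lemma₂ = solve-∀
    forth : ∀ y → p∣ (y * y - u) → p∣ (y - 0ℤ)
    forth y d = subst p∣_ (sym (+-identityʳ y)) ([ id , id ]′ (p∣-* y y (∣-combine 1ℤ 1ℤ d p∣u (lemma₁ y u))))
    back : ∀ y → p∣ (y - 0ℤ) → p∣ (y * y - u)
    back y d = ∣-combine y -1ℤ d p∣u (lemma₂ y u)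

  -- Multiplication by y carries the square roots of v bijectively to those of y²v.
  χ-square-* : ∀ {y} → ¬ p∣ y → ∀ v → χ (y * y * v) ≡ χ v
  χ-square-* {y} p∤y v = begin
    χ (y * y * v)                                          ≡⟨ χ-def (y * y * v) ⟩
    Σₚ (λ z → δ (z * z - y * y * v)) - 1ℤ                  ≡⟨ cong (_- 1ℤ) (Σ-affine periodic y 0ℤ p∤y) ⟨
    Σₚ (λ z → δ ((y * z + 0ℤ) * (y * z + 0ℤ) - y * y * v)) - 1ℤ
      ≡⟨ cong (_- 1ℤ) (Σ-cong λ z → δ-⇔ (forth z) (λ d → ∣-scale (y * y) d (factor y z v))) ⟩
    Σₚ (λ z → δ (z * z - v)) - 1ℤ                          ≡⟨ χ-def v ⟨
    χ v                                                    ∎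
    where
    open ≡-Reasoning
    periodicity : ∀ x z w → x * x - w - (z * z - w) ≡ (x + z) * (x - z)
    periodicity = solve-∀
    periodic : Periodic (λ z → δ (z * z - y * y * v))
    periodic x z x≈z = δ-periodic _ _ (∣-scale (x + z) x≈z (periodicity x z (y * y * v)))
    factor : ∀ y z v → (y * z + 0ℤ) * (y * z + 0ℤ) - y * y * v ≡ y * y * (z * z - v)
    factor = solve-∀
    forth : ∀ z → p∣ ((y * z + 0ℤ) * (y * z + 0ℤ) - y * y * v) → p∣ (z * z - v)
    forth z d = [ (λ p∣yy → ⊥-elim ([ p∤y , p∤y ]′ (p∣-* y y p∣yy))) , id ]′
                (p∣-* (y * y) (z * z - v) (subst p∣_ (factor y z v) d))

  -- Multiplicativity of the character for odd `p`.

  module OddPrime (p≢2 : p ≢ 2) where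

    p∤2 : ¬ p∣ (+ 2)
    p∤2 p∣2 = p≢2 (ℕ.≤-antisym (ℕ.∣⇒≤ (∣⇒∣ᵤ p∣2)) (ℕ.nonTrivial⇒n>1 p {{prime⇒nonTrivial p-prime}}))

    χ-1 : χ 1ℤ ≡ 1ℤ
    χ-1 = begin
      χ 1ℤ                                   ≡⟨ χ-def 1ℤ ⟩
      Σₚ (λ y → δ (y * y - 1ℤ)) - 1ℤ         ≡⟨ cong (_- 1ℤ) (Σ-cong λ y → trans (cong δ (factor y)) (δ-* (y - -1ℤ) (y - 1ℤ))) ⟩
      Σₚ (λ y → δ (y - -1ℤ) + δ (y - 1ℤ) - δ (y - -1ℤ) * δ (y - 1ℤ)) - 1ℤ
        ≡⟨ cong (_- 1ℤ) (Σ-minus (λ y → δ (y - -1ℤ) + δ (y - 1ℤ)) (λ y → δ (y - -1ℤ) * δ (y - 1ℤ))) ⟩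
      Σₚ (λ y → δ (y - -1ℤ) + δ (y - 1ℤ)) - Σₚ (λ y → δ (y - -1ℤ) * δ (y - 1ℤ)) - 1ℤ
        -- The overlap of the roots -1 and 1 sifts to `δ (+ 2)`, which vanishes because p is odd.
        ≡⟨ cong₂ (λ s t → s - t - 1ℤ)
             (trans (Σ-plus (λ y → δ (y - -1ℤ)) (λ y → δ (y - 1ℤ))) (cong₂ _+_ (Σ-δ -1ℤ) (Σ-δ 1ℤ)))
             (trans (Σ-sift (λ x y x≈y → δ-periodic _ _ (∣-scale 1ℤ x≈y (shift x y))) 1ℤ) (δ-false p∤2)) ⟩
      1ℤ                                     ∎
      where
      open ≡-Reasoning
      factor : ∀ y → y * y - 1ℤ ≡ (y - -1ℤ) * (y - 1ℤ)
      factor = solve-∀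
      shift : ∀ x y → x - -1ℤ - (y - -1ℤ) ≡ 1ℤ * (x - y)
      shift = solve-∀

    -- The square case records invariance under multiplication by u, since this is available before
    -- `χ-*` and is used to prove it.
    data Class (u : ℤ) : Set where
      multiple  : p∣ u → χ u ≡ 0ℤ → Class u
      square    : ¬ p∣ u → (∀ v → χ (u * v) ≡ χ v) → χ u ≡ 1ℤ → Class u
      nonsquare : ¬ p∣ u → χ u ≡ -1ℤ → Class u

    classify : ∀ u → Class u
    classify u with + p ∣? u
    ... | yes p∣u = multiple p∣u (χ-multiple p∣u)
    ... | no  p∤u with any? {p} (λ i → + p ∣? residue i * residue i - u)
    ...   | yes (i , d) = square p∤u u-invariant (begin
      χ u          ≡⟨ cong χ (*-identityʳ u) ⟨
      χ (u * 1ℤ)   ≡⟨ u-invariant 1ℤ ⟩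
      χ 1ℤ         ≡⟨ χ-1 ⟩
      1ℤ           ∎)
      where
      open ≡-Reasoning
      y = residue i
      lemma : ∀ u v y → u * v - y * y * v ≡ - v * (y * y - u)
      lemma = solve-∀
      p∤y : ¬ p∣ y
      p∤y p∣y = p∤u (p∣-transport (y * y) u d (∣m⇒∣m*n y p∣y))
      u-invariant : ∀ v → χ (u * v) ≡ χ v
      u-invariant v = trans (χ-periodic (u * v) (y * y * v) (∣-scale (- v) d (lemma u v y))) (χ-square-* p∤y v)
    ...   | no  ¬sq     = nonsquare p∤u (trans (χ-def u) (cong (_- 1ℤ)
                            (Σ-0 λ i → δ-false λ d → ¬sq (i , d))))

    χ≤1 : ∀ u → χ u ≤ 1ℤ
    χ≤1 u with classify u
    ... | multiple _ χu     rewrite χu = +≤+ ℕ.z≤n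
    ... | square _ _ χu   rewrite χu = ≤-refl
    ... | nonsquare _ χu    rewrite χu = -≤+

    χ² : ∀ u → χ u * χ u ≡ 1ℤ - δ u
    χ² u with classify u
    ... | multiple p∣u χu     rewrite χu | δ-true p∣u = refl
    ... | square p∤u _ χu   rewrite χu | δ-false p∤u = refl
    ... | nonsquare p∤u χu    rewrite χu | δ-false p∤u = refl

    -- The sum over v vanishes while no term is positive.
    χ-nonsquare-* : ∀ {u} → ¬ p∣ u → χ u ≡ -1ℤ → ∀ v → χ (u * v) + χ v ≡ 0ℤ
    χ-nonsquare-* {u} p∤u χu≡-1 v = trans
      -- Termwise vanishing is obtained at least residues only; periodicity carries it to v.
      (sym (cong₂ _+_ (χ-periodic _ _ (∣-scale u (residue-rep v) (lemma u (residue (rep v)) v))) (χ-periodic _ _ (residue-rep v))))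
      (Σ-≤0-≡0 nonpositive total (rep v))
      where
      open ≡-Reasoning
      lemma : ∀ u r v → u * r - u * v ≡ u * (r - v)
      lemma = solve-∀
      total : Σₚ (λ v → χ (u * v) + χ v) ≡ 0ℤ
      total = begin
        Σₚ (λ v → χ (u * v) + χ v)           ≡⟨ Σ-plus (λ v → χ (u * v)) χ ⟩
        Σₚ (λ v → χ (u * v)) + Σₚ χ          ≡⟨ cong (_+ Σₚ χ) (Σ-cong λ v → cong χ (+-identityʳ (u * v))) ⟨
        Σₚ (λ v → χ (u * v + 0ℤ)) + Σₚ χ     ≡⟨ cong (_+ Σₚ χ) (Σ-affine χ-periodic u 0ℤ p∤u) ⟩
        Σₚ χ + Σₚ χ                          ≡⟨ cong₂ _+_ Σχ≡0 Σχ≡0 ⟩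
        0ℤ                                   ∎
      nonpositive : ∀ v → χ (u * v) + χ v ≤ 0ℤ
      nonpositive v with classify v
      ... | multiple p∣v χv = ≤-reflexive (cong₂ _+_ (χ-multiple (∣n⇒∣m*n u p∣v)) χv)
      -- For a square v the roles are exchanged: invariance under v gives χ(uv) = χ(u) = -1. For a
      -- nonsquare v the bound χ(uv) ≤ 1 suffices.
      ... | square _ v-invariant χv = ≤-reflexive (cong₂ _+_
        (trans (cong χ (*-comm u v)) (trans (v-invariant u) χu≡-1)) χv)
      ... | nonsquare _ χv = +-mono-≤ (χ≤1 (u * v)) (≤-reflexive χv)

    χ-* : ∀ u v → χ (u * v) ≡ χ u * χ v
    χ-* u v with classify u
    ... | multiple p∣u χu rewrite χu = χ-multiple (∣m⇒∣m*n v p∣u)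
    ... | square _ u-invariant χu rewrite χu = trans (u-invariant v) (sym (*-identityˡ (χ v)))
    ... | nonsquare p∤u χu rewrite χu = begin
      χ (u * v)                     ≡⟨ lemma (χ (u * v)) (χ v) ⟩
      χ (u * v) + χ v + -1ℤ * χ v   ≡⟨ cong (_+ -1ℤ * χ v) (χ-nonsquare-* p∤u χu v) ⟩
      0ℤ + -1ℤ * χ v                ≡⟨ +-identityˡ (-1ℤ * χ v) ⟩
      -1ℤ * χ v                     ∎
      where
      open ≡-Reasoning
      lemma : ∀ a b → a ≡ a + b + -1ℤ * b
      lemma = solve-∀

    -- Correlations of the character with its shifts.

    Σχ² : Σₚ (λ x → χ x * χ x) ≡ + p - 1ℤ
    Σχ² = begin
      Σₚ (λ x → χ x * χ x)                     ≡⟨ Σ-cong χ² ⟩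
      Σₚ (λ x → 1ℤ - δ x)                      ≡⟨ Σ-minus (λ _ → 1ℤ) δ ⟩
      Σₚ (λ _ → 1ℤ) - Σₚ δ                     ≡⟨ cong₂ _-_ Σ-1 Σδ ⟩
      + p - 1ℤ                                 ∎
      where open ≡-Reasoning

    χ²-unit : ∀ {u} → ¬ p∣ u → χ u * χ u ≡ 1ℤ
    χ²-unit {u} p∤u = trans (χ² u) (cong (_-_ 1ℤ) (δ-false p∤u))

    correlation : ℤ → ℤ
    correlation d = Σₚ (λ t → χ t * χ (t + d))

    shift-periodic : ∀ d → Periodic (λ t → χ t * χ (t + d))
    shift-periodic d x y x≈y = cong₂ _*_ (χ-periodic x y x≈y) (χ-periodic _ _ (∣-scale 1ℤ x≈y (lemma x y d)))
      where
      lemma : ∀ x y d → x + d - (y + d) ≡ 1ℤ * (x - y)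
      lemma = solve-∀

    correlation-multiple : ∀ {d} → p∣ d → correlation d ≡ + p - 1ℤ
    correlation-multiple {d} p∣d = trans
      (Σ-cong λ t → cong (χ t *_) (χ-periodic _ _ (∣-scale 1ℤ p∣d (lemma t d))))
      Σχ²
      where
      lemma : ∀ t d → t + d - t ≡ 1ℤ * d
      lemma = solve-∀

    -- Replacing t by dt pulls the factor χ(d)² = 1 out of the sum.
    correlation-unit : ∀ {d} → ¬ p∣ d → correlation d ≡ correlation 1ℤ
    correlation-unit {d} p∤d = begin
      correlation d                                          ≡⟨ Σ-affine (shift-periodic d) d 0ℤ p∤d ⟨
      Σₚ (λ t → χ (d * t + 0ℤ) * χ (d * t + 0ℤ + d))         ≡⟨ Σ-cong scale ⟩
      correlation 1ℤ                                         ∎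
      where
      open ≡-Reasoning
      lemma : ∀ d t → d * t + 0ℤ + d ≡ d * (t + 1ℤ)
      lemma = solve-∀
      regroup : ∀ a b c → a * b * (a * c) ≡ a * a * (b * c)
      regroup = solve-∀
      scale : ∀ t → χ (d * t + 0ℤ) * χ (d * t + 0ℤ + d) ≡ χ t * χ (t + 1ℤ)
      scale t = begin
        χ (d * t + 0ℤ) * χ (d * t + 0ℤ + d)      ≡⟨ cong₂ (λ v w → χ v * χ w) (+-identityʳ (d * t)) (lemma d t) ⟩
        χ (d * t) * χ (d * (t + 1ℤ))             ≡⟨ cong₂ _*_ (χ-* d t) (χ-* d (t + 1ℤ)) ⟩
        χ d * χ t * (χ d * χ (t + 1ℤ))           ≡⟨ regroup (χ d) (χ t) (χ (t + 1ℤ)) ⟩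
        χ d * χ d * (χ t * χ (t + 1ℤ))           ≡⟨ cong (_* (χ t * χ (t + 1ℤ))) (χ²-unit p∤d) ⟩
        1ℤ * (χ t * χ (t + 1ℤ))                  ≡⟨ *-identityˡ (χ t * χ (t + 1ℤ)) ⟩
        χ t * χ (t + 1ℤ)                         ∎

    correlation-δ : ∀ d → correlation d ≡ correlation 1ℤ + (+ p - 1ℤ - correlation 1ℤ) * δ d
    correlation-δ d with + p ∣? d
    ... | yes p∣d rewrite δ-true p∣d = trans (correlation-multiple p∣d) (lemma (+ p - 1ℤ) (correlation 1ℤ))
      where
      lemma : ∀ a k → a ≡ k + (a - k) * 1ℤ
      lemma = solve-∀
    ... | no  p∤d rewrite δ-false p∤d = trans (correlation-unit p∤d) (lemma (+ p - 1ℤ) (correlation 1ℤ))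
      where
      lemma : ∀ a k → k ≡ k + (a - k) * 0ℤ
      lemma = solve-∀

    -- Summing over the shift d for fixed t leaves a full sum of χ.
    Σ-correlation : Σₚ correlation ≡ 0ℤ
    Σ-correlation = begin
      Σₚ correlation                                  ≡⟨ Σ-swap (λ d t → χ t * χ (t + d)) ⟩
      Σₚ (λ t → Σₚ (λ d → χ t * χ (t + d)))           ≡⟨ Σ-cong (λ t → trans (Σ-*ˡ (χ t) (λ d → χ (t + d))) (cong (χ t *_) (translate t))) ⟩
      Σₚ (λ t → χ t * 0ℤ)                             ≡⟨ Σ-0 (λ i → *-zeroʳ (χ (residue i))) ⟩
      0ℤ                                              ∎
      where
      open ≡-Reasoning
      lemma : ∀ t d → t + d ≡ 1ℤ * d + t
      lemma = solve-∀
      translate : ∀ t → Σₚ (λ d → χ (t + d)) ≡ 0ℤ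
      translate t = trans (Σ-cong λ d → cong χ (lemma t d)) (trans (Σ-affine χ-periodic 1ℤ t p∤1) Σχ≡0)

    -- Among the p correlations, which add up to 0, one is p - 1 and the other p - 1 equal k; hence
    -- (p - 1)(k + 1) = 0.
    correlation-1 : correlation 1ℤ ≡ -1ℤ
    correlation-1 = i-j≡0⇒i≡j k -1ℤ ([ ⊥-elim ∘ p-1≢0 , id ]′ (i*j≡0⇒i≡0∨j≡0 (+ p - 1ℤ) {k - -1ℤ} product≡0))
      where
      open ≡-Reasoning
      k = correlation 1ℤ
      l = + p - 1ℤ - k
      lemma : ∀ n k → (n - 1ℤ) * (k - -1ℤ) ≡ n * k + (n - 1ℤ - k) * 1ℤ
      lemma = solve-∀
      p-1≢0 : + p - 1ℤ ≢ 0ℤ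
      p-1≢0 p-1≡0 = p∤1 (subst p∣_ (i-j≡0⇒i≡j (+ p) 1ℤ p-1≡0) ∣-refl)
      expand : Σₚ (λ d → k + l * δ d) ≡ + p * k + l * 1ℤ
      expand = begin
        Σₚ (λ d → k + l * δ d)                    ≡⟨ Σ-plus (λ _ → k) (λ d → l * δ d) ⟩
        Σₚ (λ _ → k) + Σₚ (λ d → l * δ d)         ≡⟨ cong₂ _+_ (Σ-const k) (trans (Σ-*ˡ l δ) (cong (l *_) Σδ)) ⟩
        + p * k + l * 1ℤ                          ∎
      product≡0 : (+ p - 1ℤ) * (k - -1ℤ) ≡ 0ℤ
      product≡0 = begin
        (+ p - 1ℤ) * (k - -1ℤ)     ≡⟨ lemma (+ p) k ⟩
        + p * k + l * 1ℤ           ≡⟨ expand ⟨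
        Σₚ (λ d → k + l * δ d)     ≡⟨ Σ-cong correlation-δ ⟨
        Σₚ correlation             ≡⟨ Σ-correlation ⟩
        0ℤ                         ∎

    correlation-value : ∀ d → correlation d ≡ + p * δ d - 1ℤ
    correlation-value d = begin
      correlation d                                              ≡⟨ correlation-δ d ⟩
      correlation 1ℤ + (+ p - 1ℤ - correlation 1ℤ) * δ d         ≡⟨ cong (λ k → k + (+ p - 1ℤ - k) * δ d) correlation-1 ⟩
      -1ℤ + (+ p - 1ℤ - -1ℤ) * δ d                               ≡⟨ lemma (+ p) (δ d) ⟩
      + p * δ d - 1ℤ                                             ∎
      where
      open ≡-Reasoning
      lemma : ∀ n e → -1ℤ + (n - 1ℤ - -1ℤ) * e ≡ n * e - 1ℤ
      lemma = solve-∀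

    correlation-nonzero : ∀ {d} → ¬ p∣ d → correlation d ≡ -1ℤ
    correlation-nonzero p∤d = trans (correlation-unit p∤d) correlation-1

    -- Reflected sums, the Jacobi sum and χ(-1) modulo 4.

    -- The sign is factored out of the second argument. It serves both the Jacobi sum, with e = -1,
    -- and the line x + y = - c / 4, with e = c / 4.
    Σ-reflected : ∀ e → Σₚ (λ x → χ x * χ (- x - e)) ≡ χ -1ℤ * correlation e
    Σ-reflected e = trans (Σ-cong reflect) (Σ-*ˡ (χ -1ℤ) (λ x → χ x * χ (x + e)))
      where
      open ≡-Reasoning
      negate : ∀ x e → - x - e ≡ -1ℤ * (x + e)
      negate = solve-∀
      swap : ∀ a b c → a * (b * c) ≡ b * (a * c)
      swap = solve-∀
      reflect : ∀ x → χ x * χ (- x - e) ≡ χ -1ℤ * (χ x * χ (x + e))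
      reflect x = begin
        χ x * χ (- x - e)              ≡⟨ cong (λ w → χ x * χ w) (negate x e) ⟩
        χ x * χ (-1ℤ * (x + e))        ≡⟨ cong (χ x *_) (χ-* -1ℤ (x + e)) ⟩
        χ x * (χ -1ℤ * χ (x + e))      ≡⟨ swap (χ x) (χ -1ℤ) (χ (x + e)) ⟩
        χ -1ℤ * (χ x * χ (x + e))      ∎

    p∤-1 : ¬ p∣ -1ℤ
    p∤-1 p∣-1 = p∤1 (∣-scale -1ℤ p∣-1 refl)

    jacobi-sum : Σₚ (λ u → χ u * χ (1ℤ - u)) ≡ - χ -1ℤ
    jacobi-sum = begin
      Σₚ (λ u → χ u * χ (1ℤ - u))        ≡⟨ Σ-cong (λ u → cong (λ w → χ u * χ w) (lemma u)) ⟩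
      Σₚ (λ u → χ u * χ (- u - -1ℤ))     ≡⟨ Σ-reflected -1ℤ ⟩
      χ -1ℤ * correlation -1ℤ            ≡⟨ cong (χ -1ℤ *_) (correlation-nonzero p∤-1) ⟩
      χ -1ℤ * -1ℤ                        ≡⟨ negate (χ -1ℤ) ⟩
      - χ -1ℤ                            ∎
      where
      open ≡-Reasoning
      lemma : ∀ u → 1ℤ - u ≡ - u - -1ℤ
      lemma = solve-∀
      negate : ∀ a → a * -1ℤ ≡ - a
      negate = solve-∀

    -- The expression is twice the indicator of the nonsquares.
    χ-parity : ∀ u → + 2 ∣ 1ℤ - δ u - χ u
    χ-parity u with classify u
    ... | multiple p∣u χu    rewrite χu | δ-true p∣u = divides 0ℤ refl
    ... | square p∤u _ χu    rewrite χu | δ-false p∤u = divides 0ℤ refl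
    ... | nonsquare p∤u χu   rewrite χu | δ-false p∤u = divides 1ℤ refl

    -- The congruence comes from summing the products of the even numbers 1 - δ - χ at u and 1 - u.
    χ[-1]-mod-4 : + 4 ∣ + p - χ -1ℤ
    χ[-1]-mod-4 = subst (+ 4 ∣_) total
      (Σ-∣ {f = λ u → F u * F (1ℤ - u)} λ u → even*even (χ-parity u) (χ-parity (1ℤ - u)))
      where
      open ≡-Reasoning
      F : ℤ → ℤ
      F u = 1ℤ - δ u - χ u
      quadruple : ∀ q r → q * + 2 * (r * + 2) ≡ q * r * + 4
      quadruple = solve-∀
      even*even : ∀ {a b} → + 2 ∣ a → + 2 ∣ b → + 4 ∣ a * b
      even*even (divides q refl) (divides r refl) = divides (q * r) (quadruple q r)
      F-periodic : Periodic F
      F-periodic x y x≈y = cong₂ (λ d c → 1ℤ - d - c) (δ-periodic x y x≈y) (χ-periodic x y x≈y)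
      reflection-periodic : Periodic (λ u → χ (1ℤ - u))
      reflection-periodic x y x≈y = χ-periodic _ _ (∣-scale -1ℤ x≈y (lemma x y))
        where
        lemma : ∀ x y → 1ℤ - x - (1ℤ - y) ≡ -1ℤ * (x - y)
        lemma = solve-∀
      -- The terms are grouped for sifting: δ(1 - u) picks out F(1) = 0, and δ(u) picks out χ(1) =
      -- 1, which cancels the -1 in the sum of F. Only p and the Jacobi sum survive.
      expand : ∀ d c d′ c′ → (1ℤ - d - c) * (1ℤ - d′ - c′)
             ≡ 1ℤ - d - c - (1ℤ - d - c) * d′ - c′ + c′ * d + c * c′
      expand = solve-∀
      product : ∀ u → F u * F (1ℤ - u)
              ≡ F u - F u * δ (u - 1ℤ) - χ (1ℤ - u) + χ (1ℤ - u) * δ (u - 0ℤ) + χ u * χ (1ℤ - u)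
      product u = trans (expand (δ u) (χ u) (δ (1ℤ - u)) (χ (1ℤ - u)))
        (cong₂ (λ d′ d → F u - F u * d′ - χ (1ℤ - u) + χ (1ℤ - u) * d + χ u * χ (1ℤ - u))
          (δ-⇔ (p∣-sym 1ℤ u) (p∣-sym u 1ℤ)) (cong δ (sym (+-identityʳ u))))
      ΣF : Σₚ F ≡ + p - 1ℤ - 0ℤ
      ΣF = trans (Σ-minus (λ u → 1ℤ - δ u) χ) (cong₂ _-_ (trans (Σ-minus (λ _ → 1ℤ) δ) (cong₂ _-_ Σ-1 Σδ)) Σχ≡0)
      F-1 : F 1ℤ ≡ 0ℤ
      F-1 = cong₂ (λ d c → 1ℤ - d - c) (δ-false p∤1) χ-1
      Σ-reflection : Σₚ (λ u → χ (1ℤ - u)) ≡ 0ℤ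
      Σ-reflection = trans (Σ-cong λ u → cong χ (lemma u)) (trans (Σ-affine χ-periodic -1ℤ 1ℤ p∤-1) Σχ≡0)
        where
        lemma : ∀ u → 1ℤ - u ≡ -1ℤ * u + 1ℤ
        lemma = solve-∀
      A = λ u → F u - F u * δ (u - 1ℤ)
      B = λ u → A u - χ (1ℤ - u)
      C = λ u → B u + χ (1ℤ - u) * δ (u - 0ℤ)
      ΣA : Σₚ A ≡ + p - 1ℤ - 0ℤ - 0ℤ
      ΣA = trans (Σ-minus F (λ u → F u * δ (u - 1ℤ))) (cong₂ _-_ ΣF (trans (Σ-sift F-periodic 1ℤ) F-1))
      ΣB : Σₚ B ≡ + p - 1ℤ - 0ℤ - 0ℤ - 0ℤ
      ΣB = trans (Σ-minus A (λ u → χ (1ℤ - u))) (cong₂ _-_ ΣA Σ-reflection)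
      ΣC : Σₚ C ≡ + p - 1ℤ - 0ℤ - 0ℤ - 0ℤ + 1ℤ
      ΣC = trans (Σ-plus B (λ u → χ (1ℤ - u) * δ (u - 0ℤ)))
                 (cong₂ _+_ ΣB (trans (Σ-sift reflection-periodic 0ℤ) χ-1))
      collect : ∀ n c → n - 1ℤ - 0ℤ - 0ℤ - 0ℤ + 1ℤ + - c ≡ n - c
      collect = solve-∀
      total : Σₚ (λ u → F u * F (1ℤ - u)) ≡ + p - χ -1ℤ
      total = begin
        Σₚ (λ u → F u * F (1ℤ - u))                    ≡⟨ Σ-cong product ⟩
        Σₚ (λ u → C u + χ u * χ (1ℤ - u))              ≡⟨ Σ-plus C (λ u → χ u * χ (1ℤ - u)) ⟩
        Σₚ C + Σₚ (λ u → χ u * χ (1ℤ - u))             ≡⟨ cong₂ _+_ ΣC jacobi-sum ⟩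
        + p - 1ℤ - 0ℤ - 0ℤ - 0ℤ + 1ℤ + - χ -1ℤ         ≡⟨ collect (+ p) (χ -1ℤ) ⟩
        + p - χ -1ℤ                                    ∎

    χ[-1]-cases : χ -1ℤ ≡ 1ℤ ⊎ χ -1ℤ ≡ -1ℤ
    χ[-1]-cases with classify -1ℤ
    ... | multiple p∣-1 _  = ⊥-elim (p∤-1 p∣-1)
    ... | square _ _ χ-1≡  = inj₁ χ-1≡
    ... | nonsquare _ χ-1≡ = inj₂ χ-1≡

    -- In both residue classes of p, the wrong sign of χ(-1) makes p - χ(-1) equal to 4k + 2.
    4∤2 : ¬ + 4 ∣ + 2
    4∤2 = from-no (+ 4 ∣? + 2)

    χ[-1]-1mod4 : ∀ k → + p ≡ + 4 * k + 1ℤ → χ -1ℤ ≡ 1ℤ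
    χ[-1]-1mod4 k p≡ with χ[-1]-cases
    ... | inj₁ χ-1≡ = χ-1≡
    ... | inj₂ χ-1≡ = ⊥-elim (4∤2 (∣-combine 1ℤ (- k) χ[-1]-mod-4 ∣-refl
      (trans (lemma k) (cong₂ (λ n c → 1ℤ * (n - c) + - k * + 4) (sym p≡) (sym χ-1≡)))))
      where
      lemma : ∀ k → + 2 ≡ 1ℤ * (+ 4 * k + 1ℤ - -1ℤ) + - k * + 4
      lemma = solve-∀

    χ[-1]-3mod4 : ∀ k → + p ≡ + 4 * k + + 3 → χ -1ℤ ≡ -1ℤ
    χ[-1]-3mod4 k p≡ with χ[-1]-cases
    ... | inj₂ χ-1≡ = χ-1≡
    ... | inj₁ χ-1≡ = ⊥-elim (4∤2 (∣-combine 1ℤ (- k) χ[-1]-mod-4 ∣-refl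
      (trans (lemma k) (cong₂ (λ n c → 1ℤ * (n - c) + - k * + 4) (sym p≡) (sym χ-1≡)))))
      where
      lemma : ∀ k → + 2 ≡ 1ℤ * (+ 4 * k + + 3 - 1ℤ) + - k * + 4
      lemma = solve-∀

    -- From point counts to character sums.

    -- Above each x lie 1 + χ(f t x) points, and the ones add up to the p in the definition of `a`.
    a-character-sum : ∀ f t → a p f t ≡ - Σₚ (λ x → χ (f t x))
    a-character-sum f t = begin
      + p - + length (points p f t)                              ≡⟨ cong (_-_ (+ p)) count ⟩
      + p - Σₚ (λ x → Σₚ (λ y → δ (y * y - f t x)))
        ≡⟨ cong (_-_ (+ p)) (Σ-cong λ x → trans (plus-minus _) (cong (_+ 1ℤ) (sym (χ-def (f t x))))) ⟩
      + p - Σₚ (λ x → χ (f t x) + 1ℤ)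
        ≡⟨ cong (_-_ (+ p)) (trans (Σ-plus (λ x → χ (f t x)) (λ _ → 1ℤ)) (cong (_+_ (Σₚ (λ x → χ (f t x)))) Σ-1)) ⟩
      + p - (Σₚ (λ x → χ (f t x)) + + p)                         ≡⟨ cancel (+ p) (Σₚ (λ x → χ (f t x))) ⟩
      - Σₚ (λ x → χ (f t x))                                     ∎
      where
      open ≡-Reasoning
      plus-minus : ∀ s → s ≡ s - 1ℤ + 1ℤ
      plus-minus = solve-∀
      cancel : ∀ n s → n - (s + n) ≡ - s
      cancel = solve-∀
      square-def : ∀ y v → y ^ 2 - v ≡ y * y - v
      square-def y v = cong (λ w → y * w - v) (*-identityʳ y)
      count : + length (points p f t) ≡ Σₚ (λ x → Σₚ (λ y → δ (y * y - f t x)))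
      count = begin
        + length (points p f t)
          ≡⟨ length-filter-product (isPoint? p f t) {p} {p} id id ⟩
        ∑ {p} (λ i → ∑ {p} (λ j → indicator (isPoint? p f t (i , j))))
          ≡⟨ sum-cong-≗ +-0-monoid {p} (λ i → sum-cong-≗ +-0-monoid {p} (λ j →
               trans (sym (δ-def (residue j ^ 2 - f t (residue i)))) (cong δ (square-def (residue j) (f t (residue i)))))) ⟩
        ∑ {p} (λ i → ∑ {p} (λ j → δ (residue j * residue j - f t (residue i))))
          ≡⟨ sum-cong-≗ +-0-monoid {p} (λ i → Σ-def (λ y → δ (y * y - f t (residue i)))) ⟨
        ∑ {p} (λ i → Σₚ (λ y → δ (y * y - f t (residue i))))
          ≡⟨ Σ-def (λ x → Σₚ (λ y → δ (y * y - f t x))) ⟨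
        Σₚ (λ x → Σₚ (λ y → δ (y * y - f t x))) ∎

    Σ-product : ∀ f g → Σₚ f * Σₚ g ≡ Σₚ (λ x → Σₚ (λ y → f x * g y))
    Σ-product f g = sym (trans (Σ-cong λ x → Σ-*ˡ (f x) g) (Σ-*ʳ (Σₚ g) f))

    correlation-affine : ∀ {n} → ¬ p∣ n → ∀ u v →
      Σₚ (λ t → χ (u + n * t) * χ (v + n * t)) ≡ + p * δ (v - u) - 1ℤ
    correlation-affine {n} p∤n u v = begin
      Σₚ (λ t → χ (u + n * t) * χ (v + n * t))
        ≡⟨ Σ-cong (λ t → cong₂ (λ w z → χ w * χ z) (+-comm u (n * t)) (lemma n t u v)) ⟩
      Σₚ (λ t → χ (n * t + u) * χ (n * t + u + (v - u)))
        ≡⟨ Σ-affine (shift-periodic (v - u)) n u p∤n ⟩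
      correlation (v - u)
        ≡⟨ correlation-value (v - u) ⟩
      + p * δ (v - u) - 1ℤ ∎
      where
      open ≡-Reasoning
      lemma : ∀ n t u v → v + n * t ≡ n * t + u + (v - u)
      lemma = solve-∀

    -- Pairs on which the quadratic takes equal values.

    quadratic : ℤ → ℤ → ℤ
    quadratic c x = (+ 4 * x + c) * x

    p∤8 : ¬ p∣ (+ 8)
    p∤8 p∣8 = [ p∤2 , (λ p∣4 → [ p∤2 , p∤2 ]′ (p∣-* (+ 2) (+ 2) p∣4)) ]′ (p∣-* (+ 2) (+ 4) p∣8)

    -- e and - w below stand for c / 4 and - c / 8 mod p, expressed through an inverse q of 8.
    Σ-level-pairs : ∀ {c} → ¬ p∣ c →
      Σₚ (λ x → Σₚ (λ y → χ x * χ y * δ (quadratic c y - quadratic c x))) ≡ + p - + 2 - χ -1ℤ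
    Σ-level-pairs {c} p∤c = begin
      Σₚ (λ x → Σₚ (λ y → χ x * χ y * δ (quadratic c y - quadratic c x)))
        ≡⟨ Σ-cong (λ x → trans (Σ-cong λ y → cong (χ x * χ y *_) (level x y)) (inner x)) ⟩
      Σₚ (λ x → χ x * χ x + χ x * χ (- x - e) - χ x * χ x * δ (x - - w))
        ≡⟨ Σ-minus (λ x → χ x * χ x + χ x * χ (- x - e)) (λ x → χ x * χ x * δ (x - - w)) ⟩
      Σₚ (λ x → χ x * χ x + χ x * χ (- x - e)) - Σₚ (λ x → χ x * χ x * δ (x - - w))
        ≡⟨ cong₂ _-_
             (trans (Σ-plus (λ x → χ x * χ x) (λ x → χ x * χ (- x - e)))
               (cong₂ _+_ Σχ² (trans (Σ-reflected e) (cong (χ -1ℤ *_) (correlation-nonzero p∤e)))))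
             (trans (Σ-sift (λ x y x≈y → cong₂ _*_ (χ-periodic x y x≈y) (χ-periodic x y x≈y)) (- w))
               (χ²-unit p∤-w)) ⟩
      -- In order: the diagonal, the other line, and the common point, subtracted because it was
      -- counted on both lines.
      + p - 1ℤ + χ -1ℤ * -1ℤ - 1ℤ
        ≡⟨ collect (+ p) (χ -1ℤ) ⟩
      + p - + 2 - χ -1ℤ ∎
      where
      open ≡-Reasoning
      q    = proj₁ (inverse (+ 8) p∤8)
      8q≈1 = proj₂ (inverse (+ 8) p∤8)
      w = q * c
      e = + 2 * w
      -- That c is a unit makes w and e units too, so the correlation at e is -1 and χ(-w)² = 1.
      p∤w : ¬ p∣ w
      p∤w p∣w = p∤c (∣-combine (+ 8) (- c) p∣w 8q≈1 (lemma q c))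
        where
        lemma : ∀ q c → c ≡ + 8 * (q * c) + - c * (q * + 8 - 1ℤ)
        lemma = solve-∀
      p∤-w : ¬ p∣ (- w)
      p∤-w p∣-w = p∤w (∣-scale -1ℤ p∣-w (lemma w))
        where
        lemma : ∀ w → w ≡ -1ℤ * - w
        lemma = solve-∀
      p∤e : ¬ p∣ e
      p∤e p∣e = [ p∤2 , p∤w ]′ (p∣-* (+ 2) w p∣e)
      factor : ∀ c x y → (+ 4 * y + c) * y - (+ 4 * x + c) * x ≡ (y - x) * (+ 4 * (y + x) + c)
      factor = solve-∀
      forth : ∀ q c x y → y - (- x - + 2 * (q * c)) ≡ + 2 * q * (+ 4 * (y + x) + c) + - (y + x) * (q * + 8 - 1ℤ)
      forth = solve-∀
      back : ∀ q c x y → + 4 * (y + x) + c ≡ + 4 * (y - (- x - + 2 * (q * c))) + - c * (q * + 8 - 1ℤ)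
      back = solve-∀
      antidiagonal : ∀ x y → δ (+ 4 * (y + x) + c) ≡ δ (y - (- x - e))
      antidiagonal x y = δ-⇔ (λ d → ∣-combine (+ 2 * q) (- (y + x)) d 8q≈1 (forth q c x y))
                             (λ d → ∣-combine (+ 4) (- c) d 8q≈1 (back q c x y))
      level : ∀ x y → δ (quadratic c y - quadratic c x)
                    ≡ δ (y - x) + δ (y - (- x - e)) - δ (y - x) * δ (y - (- x - e))
      level x y = trans (cong δ (factor c x y)) (trans (δ-* (y - x) (+ 4 * (y + x) + c))
        (cong (λ d → δ (y - x) + d - δ (y - x) * d) (antidiagonal x y)))
      -- The lines y = x and y = - x - e meet at x = - e / 2 = - w; cancelling the 2 uses that p is
      -- odd.
      double : ∀ x w → x - (- x - + 2 * w) ≡ + 2 * (x - - w)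
      double = solve-∀
      meeting : ∀ x → δ (x - (- x - e)) ≡ δ (x - - w)
      meeting x = trans (cong δ (double x w)) (δ-⇔
        (λ d → [ (λ p∣2 → ⊥-elim (p∤2 p∣2)) , id ]′ (p∣-* (+ 2) (x - - w) d))
        (∣n⇒∣m*n (+ 2)))
      χδ-periodic : ∀ b → Periodic (λ y → χ y * δ (y - b))
      χδ-periodic b x y x≈y = cong₂ _*_ (χ-periodic x y x≈y) (δ-periodic _ _ (∣-scale 1ℤ x≈y (lemma x y b)))
        where
        lemma : ∀ x y b → x - b - (y - b) ≡ 1ℤ * (x - y)
        lemma = solve-∀
      -- In the last term d stands outermost, so that sifting at y = x treats the other delta as
      -- part of the periodic function.
      distribute : ∀ a b d d′ → a * b * (d + d′ - d * d′) ≡ a * (b * d + b * d′ - b * d′ * d)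
      distribute = solve-∀
      redistribute : ∀ a b d → a * (a + b - a * d) ≡ a * a + a * b - a * a * d
      redistribute = solve-∀
      inner : ∀ x → Σₚ (λ y → χ x * χ y * (δ (y - x) + δ (y - (- x - e)) - δ (y - x) * δ (y - (- x - e))))
                  ≡ χ x * χ x + χ x * χ (- x - e) - χ x * χ x * δ (x - - w)
      inner x = begin
        Σₚ (λ y → χ x * χ y * (δ (y - x) + δ (y - (- x - e)) - δ (y - x) * δ (y - (- x - e))))
          ≡⟨ Σ-cong (λ y → distribute (χ x) (χ y) (δ (y - x)) (δ (y - (- x - e)))) ⟩
        Σₚ (λ y → χ x * (f y + g y - h y))
          ≡⟨ Σ-*ˡ (χ x) (λ y → f y + g y - h y) ⟩
        χ x * Σₚ (λ y → f y + g y - h y)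
          ≡⟨ cong (χ x *_) (trans (Σ-minus (λ y → f y + g y) h) (cong (_- Σₚ h) (Σ-plus f g))) ⟩
        χ x * (Σₚ f + Σₚ g - Σₚ h)
          ≡⟨ cong (χ x *_) (cong₂ _-_ (cong₂ _+_ (Σ-sift χ-periodic x) (Σ-sift χ-periodic (- x - e)))
               (trans (Σ-sift (χδ-periodic (- x - e)) x) (cong (χ x *_) (meeting x)))) ⟩
        χ x * (χ x + χ (- x - e) - χ x * δ (x - - w))
          ≡⟨ redistribute (χ x) (χ (- x - e)) (δ (x - - w)) ⟩
        χ x * χ x + χ x * χ (- x - e) - χ x * χ x * δ (x - - w) ∎
        where
        f g h : ℤ → ℤ
        f y = χ y * δ (y - x)
        g y = χ y * δ (y - (- x - e))
        h y = χ y * δ (y - (- x - e)) * δ (y - x)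
      collect : ∀ n c → n - 1ℤ + c * -1ℤ - 1ℤ ≡ n - + 2 - c
      collect = solve-∀

    -- Assembly of the second moment.

    second-moment : ∀ m n → ¬ p∣ n → ¬ p∣ (+ 4 * m + 1ℤ) → A₂ p (E m n) ≡ + p * (+ p - + 2 - χ -1ℤ)
    second-moment m n p∤n p∤c = begin
      A₂ p (E m n)
        ≡⟨ Σ-def (λ t → a p (E m n) t ^ 2) ⟨
      Σₚ (λ t → a p (E m n) t ^ 2)
        ≡⟨ Σ-cong square-a ⟩
      Σₚ (λ t → Σₚ (λ x → Σₚ (λ y → G t x * G t y)))
        ≡⟨ Σ-swap (λ t x → Σₚ (λ y → G t x * G t y)) ⟩
      Σₚ (λ x → Σₚ (λ t → Σₚ (λ y → G t x * G t y)))
        ≡⟨ Σ-cong (λ x → trans (Σ-swap (λ t y → G t x * G t y)) (Σ-cong (inner x))) ⟩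
      Σₚ (λ x → Σₚ (λ y → + p * L x y - χ x * χ y))
        ≡⟨ Σ-cong (λ x → trans (Σ-minus (λ y → + p * L x y) (λ y → χ x * χ y))
                        (cong (_- Σₚ (λ y → χ x * χ y)) (Σ-*ˡ (+ p) (L x)))) ⟩
      Σₚ (λ x → + p * Σₚ (L x) - Σₚ (λ y → χ x * χ y))
        ≡⟨ Σ-minus (λ x → + p * Σₚ (L x)) (λ x → Σₚ (λ y → χ x * χ y)) ⟩
      Σₚ (λ x → + p * Σₚ (L x)) - Σₚ (λ x → Σₚ (λ y → χ x * χ y))
        -- The constant -1 of the correlation contributes the square of the full sum of χ, which is
        -- 0.
        ≡⟨ cong₂ _-_ (trans (Σ-*ˡ (+ p) (λ x → Σₚ (L x))) (cong (+ p *_) (Σ-level-pairs p∤c)))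
                     (trans (sym (Σ-product χ χ)) (cong (_* Σₚ χ) Σχ≡0)) ⟩
      + p * (+ p - + 2 - χ -1ℤ) - 0ℤ
        ≡⟨ +-identityʳ (+ p * (+ p - + 2 - χ -1ℤ)) ⟩
      + p * (+ p - + 2 - χ -1ℤ) ∎
      where
      open ≡-Reasoning
      U : ℤ → ℤ
      U = quadratic (+ 4 * m + 1ℤ)
      G L : ℤ → ℤ → ℤ
      G t x = χ x * χ (U x + n * t)
      L x y = χ x * χ y * δ (U y - U x)
      -- The powers are written as `_^_` unfolds them, ending in the factor 1 of the zeroth power.
      factor : ∀ m n t x → + 4 * (x * (x * (x * 1ℤ))) + (+ 4 * m + 1ℤ) * (x * (x * 1ℤ)) + n * t * x
                         ≡ x * ((+ 4 * x + (+ 4 * m + 1ℤ)) * x + n * t)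
      factor = solve-∀
      character : ∀ t x → χ (E m n t x) ≡ G t x
      character t x = trans (cong χ (factor m n t x)) (χ-* x (U x + n * t))
      neg-square : ∀ s → - s * (- s * 1ℤ) ≡ s * s
      neg-square = solve-∀
      square-a : ∀ t → a p (E m n) t ^ 2 ≡ Σₚ (λ x → Σₚ (λ y → G t x * G t y))
      square-a t = begin
        a p (E m n) t ^ 2                                ≡⟨ cong (_^ 2) (a-character-sum (E m n) t) ⟩
        (- Σₚ (λ x → χ (E m n t x))) ^ 2                 ≡⟨ neg-square (Σₚ (λ x → χ (E m n t x))) ⟩
        Σₚ (λ x → χ (E m n t x)) * Σₚ (λ x → χ (E m n t x)) ≡⟨ cong (λ s → s * s) (Σ-cong (character t)) ⟩
        Σₚ (G t) * Σₚ (G t)                              ≡⟨ Σ-product (G t) (G t) ⟩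
        Σₚ (λ x → Σₚ (λ y → G t x * G t y))              ∎
      regroup : ∀ a b c d → a * c * (b * d) ≡ a * b * (c * d)
      regroup = solve-∀
      distribute : ∀ n a d → a * (n * d - 1ℤ) ≡ n * (a * d) - a
      distribute = solve-∀
      inner : ∀ x y → Σₚ (λ t → G t x * G t y) ≡ + p * L x y - χ x * χ y
      inner x y = begin
        Σₚ (λ t → G t x * G t y)
          ≡⟨ Σ-cong (λ t → regroup (χ x) (χ y) (χ (U x + n * t)) (χ (U y + n * t))) ⟩
        Σₚ (λ t → χ x * χ y * (χ (U x + n * t) * χ (U y + n * t)))
          ≡⟨ Σ-*ˡ (χ x * χ y) (λ t → χ (U x + n * t) * χ (U y + n * t)) ⟩
        χ x * χ y * Σₚ (λ t → χ (U x + n * t) * χ (U y + n * t))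
          ≡⟨ cong (χ x * χ y *_) (correlation-affine p∤n (U x) (U y)) ⟩
        χ x * χ y * (+ p * δ (U y - U x) - 1ℤ)
          ≡⟨ distribute (+ p) (χ x * χ y) (δ (U y - U x)) ⟩
        + p * L x y - χ x * χ y ∎

lemma2p5 : (m n : ℤ) (p : ℕ) → Prime p → p ≢ 2 →
    ¬ (+ p ∣ n) → ¬ (+ p ∣ + 4 * m + + 1) →
    ((∃[ k ] + p ≡ + 4 * k + + 1) → A₂ p (E m n) ≡ (+ p) ^ 2 - + 3 * + p)
    × ((∃[ k ] + p ≡ + 4 * k + + 3) → A₂ p (E m n) ≡ (+ p) ^ 2 - + p)
lemma2p5 m n p p-prime p≢2 p∤n p∤4m+1 =
    (λ (k , p≡) → trans moment (trans (cong value (χ[-1]-1mod4 k p≡)) (value-1 (+ p))))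
  , (λ (k , p≡) → trans moment (trans (cong value (χ[-1]-3mod4 k p≡)) (value-3 (+ p))))
  where
  open Residues p-prime
  open OddPrime p≢2
  moment : A₂ p (E m n) ≡ + p * (+ p - + 2 - χ -1ℤ)
  moment = second-moment m n p∤n p∤4m+1
  value : ℤ → ℤ
  value c = + p * (+ p - + 2 - c)
  value-1 : ∀ q → q * (q - + 2 - 1ℤ) ≡ q * (q * 1ℤ) - + 3 * q
  value-1 = solve-∀
  value-3 : ∀ q → q * (q - + 2 - -1ℤ) ≡ q * (q * 1ℤ) - q
  value-3 = solve-∀
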